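{- Let $Y$ be a topological space such that $|Y|\geq 2^{\mathfrak c}$. Then the relation $\omega^{*}\rightarrow(Y)^{1}_{2}$ fails; that is, there are sets $P_0,P_1$ with $\omega^{*}=P_0\cup P_1$ such that neither $P_0$ nor $P_1$ contains a subspace homeomorphic to $Y$.
   Context: $\mathfrak c=2^{\aleph_0}$. $\omega$ is the countably infinite discrete space, $\beta(\omega)$ its Stone-Čech compactification, and $\omega^{*}=\beta(\omega)\setminus\omega$ with the subspace topology. For topological spaces $X,Y$, the relation $X\rightarrow(Y)^{1}_{2}$ means: whenever $X=P_0\cup P_1$, there are $i\in\{0,1\}$ and $Y'\subseteq P_i$ such that $Y'$ (with the subspace topology from $X$) is homeomorphic to $Y$. -}

-- The definitions below are axiom-free.  The classical setting is recovered
-- by assuming ExcludedMiddle and Extensionality at all levels: deciding every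
-- type A, rather than every proposition, yields a map ¬ ¬ A → A and hence,
-- together with function extensionality, the axiom of choice.

module Defs where

open import Data.Bool.Base using (Bool; true; false; T; not; _∧_)
open import Data.Irrelevant using ([_])
open import Data.Nat.Base using (ℕ)
open import Data.Product.Base using (_×_; _,_; proj₁; proj₂; Σ-syntax; ∃-syntax)
open import Data.Refinement using (Refinement-syntax; _,_; value)
open import Data.Sum.Base using (_⊎_; inj₁; inj₂)
open import Data.Unit.Polymorphic.Base using (⊤)
open import Function.Base using (_∘_; id)
open import Function.Bundles using (_↔_; _↣_; module Inverse)
open import Level using (Level; 0ℓ; suc; _⊔_)
open import Relation.Binary.PropositionalEquality.Core using (_≡_)
open import Relation.Nullary.Negation.Core using (¬_)
open import Relation.Unary using (Pred; _∈_; _⊆_; _≐_; _∪_; _∩_; ∁; ⋃; Universal; _⊢_)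

private
  variable
    a c c′ ℓ o o′ : Level

------------------------------------------------------------------------
-- Topological spaces

-- Subsets are predicates at level ℓ.  The empty set is open because it is
-- the union of the empty family.  For ℓ ≥ c the families in open-⋃ are,
-- under excluded middle, arbitrary (index them by subsets of Carrier).
record TopologicalSpace (c ℓ o : Level) : Set (suc (c ⊔ ℓ ⊔ o)) where
  field
    Carrier   : Set c
    IsOpen    : Pred (Pred Carrier ℓ) o
    open-resp : ∀ {U V} → U ≐ V → IsOpen U → IsOpen V
    open-univ : IsOpen (λ _ → ⊤)
    open-∩    : ∀ {U V} → IsOpen U → IsOpen V → IsOpen (U ∩ V)
    open-⋃    : ∀ (I : Set ℓ) (U : I → Pred Carrier ℓ) →
                (∀ i → IsOpen (U i)) → IsOpen (⋃ I U)

open TopologicalSpace public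

Continuous : (X : TopologicalSpace c ℓ o) (Y : TopologicalSpace c′ ℓ o′) →
             (Carrier X → Carrier Y) → Set (c′ ⊔ suc ℓ ⊔ o ⊔ o′)
Continuous X Y f = ∀ V → IsOpen Y V → IsOpen X (f ⊢ V)

infix 4 _≅_

record _≅_ (X : TopologicalSpace c ℓ o) (Y : TopologicalSpace c′ ℓ o′) :
           Set (c ⊔ c′ ⊔ suc ℓ ⊔ o ⊔ o′) where
  field
    bijection       : Carrier X ↔ Carrier Y
    to-continuous   : Continuous X Y (Inverse.to bijection)
    from-continuous : Continuous Y X (Inverse.from bijection)

-- The carrier is a refinement type, not a Σ-type, so that a point of X
-- occurs only once in the subspace even if its membership has many proofs.
subspace : (X : TopologicalSpace c ℓ o) → Pred (Carrier X) a →
           TopologicalSpace (c ⊔ a) ℓ (c ⊔ a ⊔ suc ℓ ⊔ o)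
subspace {ℓ = ℓ} X A = record
  { Carrier   = [ x ∈ Carrier X ∣ A x ]
  ; IsOpen    = λ V → Σ[ U ∈ Pred (Carrier X) ℓ ] IsOpen X U × V ≐ (value ⊢ U)
  ; open-resp = λ (V⊆W , W⊆V) (U , U-open , V⊆U , U⊆V) →
                  U , U-open , (λ x∈W → V⊆U (W⊆V x∈W)) , (λ x∈U → V⊆W (U⊆V x∈U))
  ; open-univ = (λ _ → ⊤) , open-univ X , id , id
  ; open-∩    = λ (U , U-open , V⊆U , U⊆V) (U′ , U′-open , V′⊆U′ , U′⊆V′) →
                  U ∩ U′ , open-∩ X U-open U′-open
                  , (λ (p , q) → V⊆U p , V′⊆U′ q)
                  , (λ (p , q) → U⊆V p , U′⊆V′ q)
  ; open-⋃    = λ I V V-open →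
                  ⋃ I (λ i → proj₁ (V-open i))
                  , open-⋃ X I _ (λ i → proj₁ (proj₂ (V-open i)))
                  , (λ (i , x∈V) → i , proj₁ (proj₂ (proj₂ (V-open i))) x∈V)
                  , (λ (i , x∈U) → i , proj₂ (proj₂ (proj₂ (V-open i))) x∈U)
  }

------------------------------------------------------------------------
-- The partition relation X → (Y)¹₂

ContainsCopy : (X : TopologicalSpace c ℓ o) → Pred (Carrier X) ℓ →
               TopologicalSpace c′ ℓ o′ → Set (c ⊔ c′ ⊔ suc ℓ ⊔ o ⊔ o′)
ContainsCopy {ℓ = ℓ} X P Y =
  Σ[ Y′ ∈ Pred (Carrier X) ℓ ] Y′ ⊆ P × subspace X Y′ ≅ Y

infix 4 _⟶⟨_⟩¹₂

_⟶⟨_⟩¹₂ : TopologicalSpace c ℓ o → TopologicalSpace c′ ℓ o′ →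
           Set (c ⊔ c′ ⊔ suc ℓ ⊔ o ⊔ o′)
_⟶⟨_⟩¹₂ {ℓ = ℓ} X Y =
  ∀ (P₀ P₁ : Pred (Carrier X) ℓ) → Universal (P₀ ∪ P₁) →
  ContainsCopy X P₀ Y ⊎ ContainsCopy X P₁ Y

------------------------------------------------------------------------
-- Power sets

-- Subsets as characteristic functions.  Under excluded middle every
-- predicate is of this form, and under function extensionality _≡_ is
-- equality of subsets, so 𝒫 A is the classical power set and has exactly
-- 2^|A| elements.
𝒫 : Set a → Set a
𝒫 A = A → Bool

infix 4 _∈ᵇ_ _⊆ᵇ_

_∈ᵇ_ : {A : Set a} → A → 𝒫 A → Set
x ∈ᵇ S = T (S x)

_⊆ᵇ_ : {A : Set a} → 𝒫 A → 𝒫 A → Set a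
R ⊆ᵇ S = ∀ x → x ∈ᵇ R → x ∈ᵇ S

-- |A| ≥ 2^𝔠, where 𝔠 = |𝒫 ℕ|.
AtLeast2^𝔠 : Set a → Set a
AtLeast2^𝔠 A = 𝒫 (𝒫 ℕ) ↣ A

------------------------------------------------------------------------
-- β(ω) as the space of ultrafilters on ω

record IsUltrafilter (u : 𝒫 (𝒫 ℕ)) : Set where
  field
    univ∈  : (λ _ → true) ∈ᵇ u
    empty∉ : ¬ ((λ _ → false) ∈ᵇ u)
    upward : ∀ R S → R ⊆ᵇ S → R ∈ᵇ u → S ∈ᵇ u
    meet   : ∀ R S → R ∈ᵇ u → S ∈ᵇ u → (λ n → R n ∧ S n) ∈ᵇ u
    ultra  : ∀ S → S ∈ᵇ u ⊎ (λ n → not (S n)) ∈ᵇ u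

Ultrafilter : Set
Ultrafilter = [ u ∈ 𝒫 (𝒫 ℕ) ∣ IsUltrafilter u ]

-- The basic clopen set {p : S ∈ p}.
hat : 𝒫 ℕ → Pred Ultrafilter 0ℓ
hat S p = S ∈ᵇ value p

private
  ∧-intro : ∀ b b′ → T b → T b′ → T (b ∧ b′)
  ∧-intro true true _ _ = _

  ∧-elim : ∀ b b′ → T (b ∧ b′) → T b × T b′
  ∧-elim true true _ = _ , _

  excluded-middle : ∀ b → T b ⊎ T (not b)
  excluded-middle true  = inj₁ _
  excluded-middle false = inj₂ _

-- The topology generated by the base of all sets hat S.
βω : TopologicalSpace 0ℓ ℓ ℓ
βω = record
  { Carrier   = Ultrafilter
  ; IsOpen    = λ U → ∀ p → p ∈ U → ∃[ S ] (p ∈ hat S × hat S ⊆ U)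
  ; open-resp = λ (U⊆V , V⊆U) U-open p p∈V →
                  let (S , p∈S , S⊆U) = U-open p (V⊆U p∈V)
                  in S , p∈S , (λ q∈S → U⊆V (S⊆U q∈S))
  ; open-univ = λ p _ → (λ _ → true) , univ∈hat p , _
  ; open-∩    = λ U-open V-open p (p∈U , p∈V) →
                  let (R , p∈R , R⊆U) = U-open p p∈U
                      (S , p∈S , S⊆V) = V-open p p∈V
                  in (λ n → R n ∧ S n) , meet∈hat R S p p∈R p∈S
                     , (λ {q} q∈ → R⊆U {q} (meetˡ R S q q∈) , S⊆V {q} (meetʳ R S q q∈))
  ; open-⋃    = λ I U U-open p (i , p∈U) →
                  let (S , p∈S , S⊆U) = U-open i p p∈U
                  in S , p∈S , (λ q∈S → i , S⊆U q∈S)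
  }
  where
  open IsUltrafilter

  -- The proof component of an ultrafilter is irrelevant, but T b can be
  -- recovered from an irrelevant proof of it.
  T-recompute : ∀ b → .(T b) → T b
  T-recompute true _ = _

  univ∈hat : ∀ p → p ∈ hat (λ _ → true)
  univ∈hat (u , [ h ]) = T-recompute _ (univ∈ h)

  meet∈hat : ∀ R S p → p ∈ hat R → p ∈ hat S → p ∈ hat (λ n → R n ∧ S n)
  meet∈hat R S (u , [ h ]) p∈R p∈S = T-recompute _ (meet h R S p∈R p∈S)

  meetˡ : ∀ R S p → p ∈ hat (λ n → R n ∧ S n) → p ∈ hat R
  meetˡ R S (u , [ h ]) p∈ =
    T-recompute _ (upward h _ R (λ n → proj₁ ∘ ∧-elim (R n) (S n)) p∈)

  meetʳ : ∀ R S p → p ∈ hat (λ n → R n ∧ S n) → p ∈ hat S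
  meetʳ R S (u , [ h ]) p∈ =
    T-recompute _ (upward h _ S (λ n → proj₂ ∘ ∧-elim (R n) (S n)) p∈)

-- The canonical embedding of ω into β(ω).
principal : ℕ → Ultrafilter
principal n = (λ S → S n) , [ record
  { univ∈  = _
  ; empty∉ = λ ()
  ; upward = λ R S R⊆S → R⊆S n
  ; meet   = λ R S → ∧-intro (R n) (S n)
  ; ultra  = λ S → excluded-middle (S n)
  } ]

ω* : TopologicalSpace 0ℓ ℓ (suc ℓ)
ω* = subspace βω (∁ (λ p → ∃[ n ] p ≡ principal n))

{-# OPTIONS --safe #-}

-- Let K = 𝒫 (𝒫 ℕ).  A continuous map h from a subspace Y₀ of ω* to ω* is
-- determined by the set of pairs (S , R) with h (Y₀ ∩ hat S) ⊆ hat R, because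
-- the sets hat S form a base and an ultrafilter is determined by the hat R
-- containing it.  If Y embeds at all, its copies are images of continuous maps
-- on one fixed copy Y₀, so there are at most |𝒫 (𝒫 ℕ × 𝒫 ℕ)| = |K| of them,
-- while each has at least |K| points.  Bernstein's construction then applies:
-- well-order K so that no proper initial segment admits an injection from K,
-- and choose, by recursion along this order, pairwise distinct points, one of
-- each colour in every copy.

module Submission where

open import Axiom.ExcludedMiddle using (ExcludedMiddle)
open import Axiom.Extensionality.Propositional using (Extensionality)
open import Data.Bool.Base using (Bool; true; false; T; _∨_; if_then_else_)
open import Data.Bool.Properties using (T-∨)
open import Data.Empty using (⊥-elim)
open import Data.Irrelevant using ([_])
open import Data.Nat.Base using (ℕ; zero; suc)
open import Data.Product.Base using (_×_; _,_; proj₁; proj₂; Σ-syntax; ∃-syntax; ∃₂)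
open import Data.Refinement using (_,_; value; value-injective)
open import Data.Sum.Base using (_⊎_; inj₁; inj₂; [_,_]′)
open import Data.Unit.Polymorphic.Base using (⊤)
open import Function.Base using (_∘_; _on_; id)
open import Function.Bundles using (_↣_; module Equivalence; module Injection; module Inverse)
open import Function.Definitions using (Injective; StrictlySurjective)
open import Function.Construct.Composition using (_↣-∘_)
open import Function.Properties.Inverse using (↔⇒↣; ↔-sym)
open import Induction.WellFounded using (Acc; acc; WellFounded; WfRec; module All; module FixPoint)
open import Level using (Level; Lift; lift; lower) renaming (suc to lsuc)
open import Relation.Binary.Construct.On using () renaming (wellFounded to on-wellFounded)
open import Relation.Binary.Core using (Rel)
open import Relation.Binary.PropositionalEquality.Core using (_≡_; _≢_; refl; sym; trans; cong; cong₂; subst)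
open import Relation.Nullary.Decidable.Core using (yes; no; ⌊_⌋; toWitness; fromWitness; decidable-stable; recompute)
open import Relation.Nullary.Negation.Core using (¬_)
open import Relation.Unary using (Pred; Universal; _∪_; _∈_; _⊆_)
open import Defs

private
  variable
    a b c ℓ o : Level

T-ext : ∀ x y → (T x → T y) → (T y → T x) → x ≡ y
T-ext true  true  _ _ = refl
T-ext true  false f _ = ⊥-elim (f _)
T-ext false true  _ g = ⊥-elim (g _)
T-ext false false _ _ = refl

-- Coding a relation on 𝒫 ℕ and a colour by an element of 𝒫 (𝒫 ℕ)

-- Swapping the arguments at each step puts `S` on the even and `R` on the odd numbers, so that
-- `interleave-double` recovers both.
interleave : 𝒫 ℕ → 𝒫 ℕ → 𝒫 ℕ
interleave S R zero    = S zero
interleave S R (suc n) = interleave R (S ∘ suc) n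

double : ℕ → ℕ
double zero    = zero
double (suc n) = suc (suc (double n))

interleave-double : ∀ S R n → interleave S R (double n) ≡ S n
interleave-double S R zero    = refl
interleave-double S R (suc n) = interleave-double (S ∘ suc) (R ∘ suc) n

cons : Bool → 𝒫 ℕ → 𝒫 ℕ
cons x S zero    = x
cons x S (suc n) = S n

Relation : Set
Relation = 𝒫 ℕ → 𝒫 ℕ → Bool

-- The first bit of the argument of `k` separates the place of the colour from those of the
-- relation, so the two can be prescribed independently.
decode : 𝒫 (𝒫 ℕ) → Bool × Relation
decode k = k (cons true (λ _ → true)) , λ S R → k (cons false (interleave S R))

decode-surjective : Extensionality _ _ → StrictlySurjective _≡_ decode
decode-surjective ext (x , r) = encode , cong (x ,_) (ext λ S → ext λ R →
  cong₂ r (ext (interleave-double S R)) (ext (interleave-double R (S ∘ suc))))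
  where
  encode : 𝒫 (𝒫 ℕ)
  encode S = if S zero then x else r (λ n → S (suc (double n))) (λ n → S (suc (suc (double n))))

-- By `small`, the order type is the initial ordinal of the cardinality of `K`.
record InitialWellOrder (K : Set a) : Set (lsuc a) where
  field
    _≺_         : Rel K a
    wellFounded : WellFounded _≺_
    connected   : ∀ x y → x ≢ y → x ≺ y ⊎ y ≺ x
    small       : ∀ y (j : K → K) → Injective _≡_ _≡_ j → ¬ (∀ x → j x ≺ y)

module Classical (em : ∀ {a} → ExcludedMiddle a)
                 (ext : ∀ {a b} → Extensionality a b) where

  by-contradiction : {A : Set a} → ¬ ¬ A → A
  by-contradiction = decidable-stable em

  -- Well-ordering

  module Zermelo {K : Set a} (next : 𝒫 K → K)
                 (next∉ : ∀ A x → ¬ x ∈ᵇ A → ¬ next A ∈ᵇ A) where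

    add : 𝒫 K → 𝒫 K
    add A x = A x ∨ ⌊ em {P = x ≡ next A} ⌋

    ⋃ᵇ : 𝒫 (𝒫 K) → 𝒫 K
    ⋃ᵇ F x = ⌊ em {P = ∃[ A ] A ∈ᵇ F × x ∈ᵇ A} ⌋

    add-cases : ∀ A {x} → x ∈ᵇ add A → x ∈ᵇ A ⊎ x ≡ next A
    add-cases A {x} x∈ = [ inj₁ , inj₂ ∘ toWitness ]′ (Equivalence.to (T-∨ {A x}) x∈)

    ⊆-add : ∀ A → A ⊆ᵇ add A
    ⊆-add A x x∈A = Equivalence.from (T-∨ {A x}) (inj₁ x∈A)

    next∈add : ∀ A → next A ∈ᵇ add A
    next∈add A = Equivalence.from (T-∨ {A (next A)}) (inj₂ (fromWitness refl))

    add-⊆ : ∀ {A C : 𝒫 K} → A ⊆ᵇ C → next A ∈ᵇ C → add A ⊆ᵇ C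
    add-⊆ {A} A⊆C n∈C x x∈ with add-cases A x∈
    ... | inj₁ x∈A  = A⊆C x x∈A
    ... | inj₂ refl = n∈C

    ⊆-antisym : ∀ {A C : 𝒫 K} → A ⊆ᵇ C → C ⊆ᵇ A → A ≡ C
    ⊆-antisym A⊆C C⊆A = ext λ x → T-ext _ _ (A⊆C x) (C⊆A x)

    add-cong : ∀ {A C} → A ⊆ᵇ C → C ⊆ᵇ A → add A ⊆ᵇ add C
    add-cong {A} {C} A⊆C C⊆A =
      subst (λ D → add A ⊆ᵇ add D) (⊆-antisym {A} {C} A⊆C C⊆A) (λ _ → id)

    -- Zermelo's chain. It starts from the empty set, the join of the empty family; its members turn
    -- out to be the initial segments of `_<_`.
    data Tower : 𝒫 K → Set a where
      step : ∀ {A} → Tower A → Tower (add A)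
      join : ∀ F → (∀ A → A ∈ᵇ F → Tower A) → Tower (⋃ᵇ F)

    ⋃-⊆ : ∀ F {C} → (∀ A → A ∈ᵇ F → A ⊆ᵇ C) → ⋃ᵇ F ⊆ᵇ C
    ⋃-⊆ F F⊆C x x∈ = let (A , A∈F , x∈A) = toWitness x∈ in F⊆C A A∈F x x∈A

    ⊆-⋃ : ∀ F A → A ∈ᵇ F → A ⊆ᵇ ⋃ᵇ F
    ⊆-⋃ F A A∈F x x∈A = fromWitness (A , A∈F , x∈A)

    Comparable : 𝒫 K → Set a
    Comparable A = ∀ {C} → Tower C → C ⊆ᵇ A ⊎ A ⊆ᵇ C

    -- Induction on the tower of `C`. The critical case has `A` between `C` and `add C`; these
    -- differ by at most the point `next C`, so whether `A` contains it decides which of the two `A`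
    -- equals.
    comparable-add : ∀ {A} → Comparable A → ∀ {C} → Tower C → C ⊆ᵇ A ⊎ add A ⊆ᵇ C
    comparable-add {A} cmp (step {C} tC) with comparable-add cmp tC
    ... | inj₂ A⁺⊆C = inj₂ λ x x∈ → ⊆-add C x (A⁺⊆C x x∈)
    ... | inj₁ C⊆A with cmp tC
    ...   | inj₂ A⊆C = inj₂ (add-cong A⊆C C⊆A)
    ...   | inj₁ _ with cmp (step tC)
    ...     | inj₁ C⁺⊆A = inj₁ C⁺⊆A
    ...     | inj₂ A⊆C⁺ with em {P = next C ∈ᵇ A}
    ...       | yes n∈A = inj₁ (add-⊆ C⊆A n∈A)
    ...       | no  n∉A = inj₂ (add-cong A⊆C C⊆A)
      where
      A⊆C : A ⊆ᵇ C
      A⊆C x x∈A with add-cases C (A⊆C⁺ x x∈A)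
      ... | inj₁ x∈C  = x∈C
      ... | inj₂ refl = ⊥-elim (n∉A x∈A)
    comparable-add {A} cmp (join F t) with em {P = ∃[ C ] C ∈ᵇ F × add A ⊆ᵇ C}
    ... | yes (C , C∈F , A⁺⊆C) = inj₂ λ x x∈ → ⊆-⋃ F C C∈F x (A⁺⊆C x x∈)
    ... | no none = inj₁ (⋃-⊆ F λ C C∈F →
      [ id , (λ A⁺⊆C → ⊥-elim (none (C , C∈F , A⁺⊆C))) ]′ (comparable-add cmp (t C C∈F)))

    comparable : ∀ {A} → Tower A → Comparable A
    comparable (step {A} tA) tC with comparable-add (comparable tA) tC
    ... | inj₁ C⊆A  = inj₁ λ x x∈ → ⊆-add A x (C⊆A x x∈)
    ... | inj₂ A⁺⊆C = inj₂ A⁺⊆C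
    comparable (join F t) {C} tC with em {P = ∃[ A ] A ∈ᵇ F × C ⊆ᵇ A}
    ... | yes (A , A∈F , C⊆A) = inj₁ λ x x∈ → ⊆-⋃ F A A∈F x (C⊆A x x∈)
    ... | no none = inj₂ (⋃-⊆ F λ A A∈F →
      [ (λ C⊆A → ⊥-elim (none (A , A∈F , C⊆A))) , id ]′ (comparable (t A A∈F) tC))

    infix 4 _<_

    _<_ : Rel K a
    x < y = ∃[ A ] Tower A × x ∈ᵇ A × ¬ y ∈ᵇ A

    <-next : ∀ {A x} → Tower A → x < next A → x ∈ᵇ A
    <-next {A} {x} tA (B , tB , x∈B , n∉B) with comparable-add (comparable tA) tB
    ... | inj₁ B⊆A  = B⊆A x x∈B
    ... | inj₂ A⁺⊆B = ⊥-elim (n∉B (A⁺⊆B _ (next∈add A)))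

    -- `M` is the largest tower member omitting `x`. If `next M` were not `x`, then `add M` would
    -- omit `x` too and hence lie in `M`, although `next M` is new.
    stage : ∀ x → ∃[ A ] Tower A × ¬ x ∈ᵇ A × next A ≡ x
    stage x = M , tM , x∉M , by-contradiction λ n≢x →
      next∉ M x x∉M (⊆-⋃ F (add M) (fromWitness (step tM , x∉M⁺ n≢x)) _ (next∈add M))
      where
      F : 𝒫 (𝒫 K)
      F A = ⌊ em {P = Tower A × ¬ x ∈ᵇ A} ⌋
      M : 𝒫 K
      M = ⋃ᵇ F
      tM : Tower M
      tM = join F λ A A∈F → proj₁ (toWitness A∈F)
      x∉M : ¬ x ∈ᵇ M
      x∉M x∈M = let (A , A∈F , x∈A) = toWitness x∈M in proj₂ (toWitness A∈F) x∈A
      x∉M⁺ : next M ≢ x → ¬ x ∈ᵇ add M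
      x∉M⁺ n≢x x∈ = [ x∉M , n≢x ∘ sym ]′ (add-cases M x∈)

    <-connected : ∀ x y → x ≢ y → x < y ⊎ y < x
    <-connected x y x≢y with stage x
    ... | A , tA , x∉A , refl with em {P = y ∈ᵇ A}
    ...   | yes y∈A = inj₂ (A , tA , y∈A , x∉A)
    ...   | no  y∉A = inj₁ (add A , step tA , next∈add A , 
      [ y∉A , x≢y ∘ sym ]′ ∘ add-cases A)

    -- By `<-next` all predecessors of `next A` lie in `A`, so accessibility spreads along the
    -- construction of the tower.
    tower⇒acc : ∀ {A} → Tower A → ∀ x → x ∈ᵇ A → Acc _<_ x
    tower⇒acc (step {A} tA) x x∈ with add-cases A x∈
    ... | inj₁ x∈A  = tower⇒acc tA x x∈A
    ... | inj₂ refl = acc λ y<n → tower⇒acc tA _ (<-next tA y<n)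
    tower⇒acc (join F t) x x∈ =
      let (A , A∈F , x∈A) = toWitness x∈ in tower⇒acc (t A A∈F) x x∈A

    <-wellFounded : WellFounded _<_
    <-wellFounded x with stage x
    ... | A , tA , _ , refl = tower⇒acc (step tA) x (next∈add A)

    Large : Pred K a
    Large y = Σ[ j ∈ (K → K) ] Injective _≡_ _≡_ j × ∀ x → j x < y

    -- If the segment below y admits an injection from K, then the order can be
    -- pulled back along the injection; for the least such y this gives the
    -- least order type.
    shrink : ∀ {y} → Acc _<_ y → Large y → InitialWellOrder K
    shrink {y} (acc rs) (j , j-inj , j<y) with em {P = ∃[ z ] z < y × Large z}
    ... | yes (z , z<y , large) = shrink (rs z<y) large
    ... | no none = record
      { _≺_         = _<_ on j
      ; wellFounded = on-wellFounded j <-wellFounded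
      ; connected   = λ x z x≢z → <-connected (j x) (j z) (x≢z ∘ j-inj)
      ; small       = λ z i i-inj i<z → none (j z , j<y z , j ∘ i , i-inj ∘ j-inj , i<z)
      }

    initialWellOrder : InitialWellOrder K
    initialWellOrder with em {P = ∃[ y ] Large y}
    ... | yes (y , large) = shrink (<-wellFounded y) large
    ... | no none = record
      { _≺_         = _<_
      ; wellFounded = <-wellFounded
      ; connected   = <-connected
      ; small       = λ y j j-inj j<y → none (y , j , j-inj , j<y)
      }

  initialWellOrder : {K : Set a} → K → InitialWellOrder K
  initialWellOrder {K = K} default = Zermelo.initialWellOrder next next∉
    where
    next : 𝒫 K → K
    next A with em {P = ∃[ x ] ¬ x ∈ᵇ A}
    ... | yes (x , _) = x
    -- Reached only when `A` is all of `K`, where `next∉` demands nothing.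
    ... | no _        = default
    next∉ : ∀ A x → ¬ x ∈ᵇ A → ¬ next A ∈ᵇ A
    next∉ A x x∉A with em {P = ∃[ x ] ¬ x ∈ᵇ A}
    ... | yes (_ , n∉A) = n∉A
    ... | no none       = ⊥-elim (none (x , x∉A))

  -- Bernstein's construction

  -- If every value of `g k` had been taken before stage `k`, sending `x` to a stage that took the
  -- value at `x` would inject `K` into the segment below `k`, against `small`.
  distinctRepresentatives :
    {K : Set a} {X : Set b} → K → (g : K → K ↣ X) →
    ∃[ f ] Injective _≡_ _≡_ f × ∀ k → ∃[ x ] f k ≡ Injection.to (g k) x
  distinctRepresentatives {K = K} {X} default g = f , f-injective , λ k →
    proj₁ (choose k (λ {k′} _ → f k′)) , unfold
    where
    open InitialWellOrder (initialWellOrder default)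

    -- rec may depend on the proof of k′ ≺ k; its value at the recomputed proof
    -- depends on k′ only.
    choose : ∀ k (rec : WfRec _≺_ (λ _ → X) k) →
             ∃[ x ] ∀ {k′} (k′≺k : k′ ≺ k) → rec (recompute em k′≺k) ≢ Injection.to (g k) x
    choose k rec = by-contradiction λ none →
      let hit : ∀ x → Hit x
          hit x = by-contradiction λ miss → none (x , λ k′≺k e → miss (_ , k′≺k , e))
      in small k (proj₁ ∘ hit) (Hit-injective (hit _) (hit _)) (λ x → proj₁ (proj₂ (hit x)))
      where
      Hit : K → Set _
      Hit x = ∃[ k′ ] Σ[ k′≺k ∈ k′ ≺ k ] rec (recompute em k′≺k) ≡ Injection.to (g k) x
      Hit-injective : ∀ {x y} (h : Hit x) (h′ : Hit y) → proj₁ h ≡ proj₁ h′ → x ≡ y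
      Hit-injective (_ , _ , e) (_ , _ , e′) refl = Injection.injective (g k) (trans (sym e) e′)

    pick : ∀ k → WfRec _≺_ (λ _ → X) k → X
    pick k rec = Injection.to (g k) (proj₁ (choose k rec))

    f : K → X
    f = All.wfRec wellFounded _ (λ _ → X) pick

    unfold : ∀ {k} → f k ≡ pick k (λ {k′} _ → f k′)
    unfold = FixPoint.unfold-wfRec wellFounded (λ _ → X) pick λ k IH≡IH′ →
      cong (λ (rec : ∀ k′ → k′ ≺ k → X) → pick k (rec _)) (ext λ _ → ext IH≡IH′)

    f-fresh : ∀ {k k′} → k′ ≺ k → f k′ ≢ f k
    f-fresh {k} k′≺k e = proj₂ (choose k (λ {k′} _ → f k′)) k′≺k (trans e unfold)

    f-injective : Injective _≡_ _≡_ f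
    f-injective {k} {k′} e = by-contradiction λ k≢k′ →
      [ (λ k≺k′ → f-fresh k≺k′ e) , (λ k′≺k → f-fresh k′≺k (sym e)) ]′ (connected k k′ k≢k′)

  -- The recursion runs over pairs of a colour and an index, enumerated by `dec`, so each `Z j` that
  -- admits an injection from `K` receives one point per colour. The other indices are served by
  -- `g₀`.
  bernstein :
    {K : Set a} {X : Set b} {J : Set c} → K → (K ↣ X) →
    (dec : K → Bool × J) → StrictlySurjective _≡_ dec →
    (Z : J → Pred X ℓ) →
    ∃[ colour ] ∀ j (g : K ↣ X) → (∀ x → Injection.to g x ∈ Z j) →
    ∀ v → ∃[ x ] x ∈ Z j × colour x ≡ v
  bernstein {K = K} {X} {J} default g₀ dec dec-surjective Z = colour , meets
    where
    Edge : J → Set _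
    Edge j = Σ[ g ∈ K ↣ X ] ∀ x → Injection.to g x ∈ Z j

    edge : J → K ↣ X
    edge j with em {P = Edge j}
    ... | yes (g , _) = g
    ... | no _        = g₀

    edge-∈ : ∀ j → Edge j → ∀ x → Injection.to (edge j) x ∈ Z j
    edge-∈ j e with em {P = Edge j}
    ... | yes (_ , g∈Z) = g∈Z
    ... | no ¬e         = ⊥-elim (¬e e)

    representatives = distinctRepresentatives default (edge ∘ proj₂ ∘ dec)
    f           = proj₁ representatives
    f-injective = proj₁ (proj₂ representatives)
    f-edge      = proj₂ (proj₂ representatives)

    -- A chosen point comes from a single `k`, as `f` is injective; points never chosen get `false`.
    colour : X → Bool
    colour x = ⌊ em {P = ∃[ k ] f k ≡ x × T (proj₁ (dec k))} ⌋

    colour-f : ∀ k → colour (f k) ≡ proj₁ (dec k)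
    colour-f k = T-ext _ _
      (λ t → let (k′ , e , c) = toWitness t in subst (T ∘ proj₁ ∘ dec) (f-injective e) c)
      (λ c → fromWitness (k , refl , c))

    meets : ∀ j (g : K ↣ X) → (∀ x → Injection.to g x ∈ Z j) →
            ∀ v → ∃[ x ] x ∈ Z j × colour x ≡ v
    meets j g g∈Z v with dec-surjective (v , j)
    ... | k , e = let (x , f≡) = f-edge k in
      f k
      , subst (_∈ Z j) (sym (trans f≡ (cong (λ p → Injection.to (edge (proj₂ p)) x) e)))
          (edge-∈ j (g , g∈Z) x)
      , trans (colour-f k) (cong proj₁ e)

  -- Copies of Y in ω*

  -- If `r S R` says that a map sends the trace of `hat S` into `hat R`, this expresses continuity
  -- at `p` with value `q`.
  Encodes : Relation → 𝒫 (𝒫 ℕ) → 𝒫 (𝒫 ℕ) → Set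
  Encodes r p q = ∀ R → (R ∈ᵇ q → ∃[ S ] S ∈ᵇ p × T (r S R)) ×
                        ((∃[ S ] S ∈ᵇ p × T (r S R)) → R ∈ᵇ q)

  Encodes-functional : ∀ {r p q q′} → Encodes r p q → Encodes r p q′ → q ≡ q′
  Encodes-functional e e′ = ext λ R → T-ext _ _
    (proj₂ (e′ R) ∘ proj₁ (e R)) (proj₂ (e R) ∘ proj₁ (e′ R))

  module _ {ℓ : Level} where

    Point : Set
    Point = Carrier (ω* {ℓ})

    Subspace : Pred Point ℓ → TopologicalSpace ℓ ℓ (lsuc ℓ)
    Subspace P = subspace ω* P

    ultrafilter : Point → 𝒫 (𝒫 ℕ)
    ultrafilter = value ∘ value

    hat-open : ∀ P R → IsOpen (Subspace P) (λ y → Lift ℓ (R ∈ᵇ ultrafilter (value y)))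
    hat-open P R =
      (λ x → Lift ℓ (R ∈ᵇ ultrafilter x))
      , ((λ p → Lift ℓ (hat R p)) , (λ p p∈R → R , lower p∈R , lift) , id , id)
      , id , id

    module _ {P Q : Pred Point ℓ} (h : Carrier (Subspace P) → Carrier (Subspace Q)) where

      code : Relation
      code S R = ⌊ em {P = ∀ p → S ∈ᵇ ultrafilter (value p) → R ∈ᵇ ultrafilter (value (h p))} ⌋

      -- The preimage of `hat R` is open, so around `p` it contains the trace of some `hat S`. The
      -- converse is immediate from the definition of `code`.
      code-encodes : Continuous (Subspace P) (Subspace Q) h →
                     ∀ p → Encodes code (ultrafilter (value p)) (ultrafilter (value (h p)))
      code-encodes h-cont p R =
        (λ R∈hp →
          let (U , (U′ , U′-open , U⊆U′ , U′⊆U) , h⁻¹V⊆U , U⊆h⁻¹V) = h-cont _ (hat-open Q R)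
              (S , p∈S , S⊆U′) = U′-open (value (value p)) (U⊆U′ (h⁻¹V⊆U {p} (lift R∈hp)))
          in S , p∈S , fromWitness λ q q∈S → lower (U⊆h⁻¹V {q} (U′⊆U (S⊆U′ q∈S))))
        , (λ (S , p∈S , hS⊆R) → toWitness hS⊆R p p∈S)

    -- Only `P` and `r` enter, so with `P` fixed all copies of `Y` occur in a family indexed by
    -- relations.
    Image : Pred Point ℓ → Relation → Pred Point ℓ
    Image P r x = ∃[ p ] Encodes r (ultrafilter (value {P = P} p)) (ultrafilter x)

    module _ {Y : TopologicalSpace c ℓ o} {P Q : Pred Point ℓ}
             (P≅Y : Subspace P ≅ Y) (Q≅Y : Subspace Q ≅ Y) where

      private
        module P = _≅_ P≅Y
        module Q = _≅_ Q≅Y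

      -- Passing through `Y` makes this a continuous bijection, so its image is all of `Q`.
      transfer : Carrier (Subspace P) → Carrier (Subspace Q)
      transfer = Inverse.from Q.bijection ∘ Inverse.to P.bijection

      transfer-encodes : ∀ p → Encodes (code transfer) (ultrafilter (value p))
                                       (ultrafilter (value (transfer p)))
      transfer-encodes = code-encodes transfer λ V V-open →
        P.to-continuous _ (Q.from-continuous V V-open)

      Q⊆Image : ∀ q → Image P (code transfer) (value q)
      Q⊆Image q = p , subst (Encodes _ _ ∘ ultrafilter ∘ value) transfer-p (transfer-encodes p)
        where
        p = Inverse.from P.bijection (Inverse.to Q.bijection q)
        transfer-p : transfer p ≡ q
        transfer-p = trans
          (cong (Inverse.from Q.bijection) (Inverse.strictlyInverseˡ P.bijection _))
          (Inverse.strictlyInverseʳ Q.bijection q)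

      Image⊆Q : Image P (code transfer) ⊆ Q
      Image⊆Q {x} (p , x-encoded) = subst Q
        (value-injective (value-injective
          (Encodes-functional (transfer-encodes p) x-encoded)))
        (member (transfer p))
        where
        -- Membership in a subspace is irrelevant, hence recomputed.
        member : ∀ (y : Carrier (Subspace Q)) → Q (value y)
        member (_ , [ y∈Q ]) = recompute em y∈Q

  subspacePoints : {P : Pred (Point {ℓ}) ℓ} {Y : TopologicalSpace c ℓ o} →
                   Subspace P ≅ Y → Carrier Y ↣ Point {ℓ}
  subspacePoints P≅Y =
    record { to = value ; cong = cong value ; injective = value-injective }
    ↣-∘ ↔⇒↣ (↔-sym (_≅_.bijection P≅Y))

  partition : (Y : TopologicalSpace c ℓ o) → AtLeast2^𝔠 (Carrier Y) →
              ∃₂ λ (P₀ P₁ : Pred (Carrier (ω* {ℓ})) ℓ) →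
                Universal (P₀ ∪ P₁) ×
                (¬ ContainsCopy ω* P₀ Y) ×
                (¬ ContainsCopy ω* P₁ Y)
  partition {ℓ = ℓ} Y large with em {P = Σ[ P ∈ Pred (Carrier (ω* {ℓ})) ℓ ] subspace ω* P ≅ Y}
  ... | no none = (λ _ → ⊤) , (λ _ → ⊤) , (λ _ → inj₁ _)
                , (λ (Q , _ , Q≅Y) → none (Q , Q≅Y)) , (λ (Q , _ , Q≅Y) → none (Q , Q≅Y))
  ... | yes (P , P≅Y) = Coloured true , Coloured false , covers
                      , avoids false (λ ()) , avoids true (λ ())
    where
    coloring : ∃[ colour ] ∀ r (g : 𝒫 (𝒫 ℕ) ↣ Point {ℓ}) →
               (∀ k → Injection.to g k ∈ Image P r) →
               ∀ v → ∃[ x ] x ∈ Image P r × colour x ≡ v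
    coloring = bernstein (λ _ → true) (subspacePoints P≅Y ↣-∘ large)
                         decode (decode-surjective ext) (Image P)

    colour : Point {ℓ} → Bool
    colour = proj₁ coloring

    Coloured : Bool → Pred (Point {ℓ}) ℓ
    Coloured v x = Lift ℓ (colour x ≡ v)

    covers : Universal (Coloured true ∪ Coloured false)
    covers x with colour x
    ... | true  = inj₁ (lift refl)
    ... | false = inj₂ (lift refl)

    -- `Q` is the image coded by `transfer` and is large because `Y` is, so it has a point of colour
    -- `v`, while all its points should have colour `w`.
    avoids : ∀ v {w} → v ≢ w → ¬ ContainsCopy ω* (Coloured w) Y
    avoids v v≢w (Q , Q⊆P , Q≅Y) =
      let g = subspacePoints Q≅Y ↣-∘ large
          (x , x∈Image , x-v) = proj₂ coloring (code (transfer P≅Y Q≅Y)) g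
            (λ k → Q⊆Image P≅Y Q≅Y
              (Inverse.from (_≅_.bijection Q≅Y) (Injection.to large k))) v
      in v≢w (trans (sym x-v) (lower (Q⊆P (Image⊆Q P≅Y Q≅Y x∈Image))))

theorem2p2 : (∀ {a} → ExcludedMiddle a) →
    (∀ {a b} → Extensionality a b) →
    ∀ {c ℓ o} (Y : TopologicalSpace c ℓ o) →
    AtLeast2^𝔠 (Carrier Y) →
    (¬ (ω* ⟶⟨ Y ⟩¹₂)) ×
    (∃₂ λ (P₀ P₁ : Pred (Carrier (ω* {ℓ})) ℓ) →
    Universal (P₀ ∪ P₁) ×
    (¬ ContainsCopy ω* P₀ Y) ×
    (¬ ContainsCopy ω* P₁ Y))
theorem2p2 em ext Y large =
  let (P₀ , P₁ , covers , no-copy₀ , no-copy₁) = Classical.partition em ext Y large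
  in (λ arrow → [ no-copy₀ , no-copy₁ ]′ (arrow P₀ P₁ covers))
     , P₀ , P₁ , covers , no-copy₀ , no-copy₁
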